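{- There is a set $A\subseteq\omega$ which is $0$-weakly stochastic but not intrinsically small.
   Context: For $B\subseteq\omega$ and $n\geq1$, $\rho_n(B)=\frac{|B\cap\{0,\dots,n-1\}|}{n}$ and $\rho(B)=\lim_n\rho_n(B)$ when it exists. $A$ is intrinsically small if $\rho(\pi(A))=0$ for every computable permutation $\pi$ of $\omega$. A skip sequence is a finite sequence $((d_0,c_0),\dots,(d_{k-1},c_{k-1}))\in(\omega\times\{0,1\})^{<\omega}$ with $d_0<\dots<d_{k-1}$; a skip rule is a total function $f$ from skip sequences to $\omega$ with $f(\sigma)$ greater than the last first coordinate of $\sigma$ for nonempty $\sigma$. Given $f$ and $A$, put $d_0=f(\emptyset)$, $d_n=f(((d_0,A(d_0)),\dots,(d_{n-1},A(d_{n-1}))))$ and $f(A)=\{n:A(d_n)=1\}$. $A$ is $0$-weakly stochastic if $\rho(f(A))=0$ for every computable skip rule $f$. -}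

module Defs where

open import Data.Nat using (ℕ; zero; suc; _+_; _<_; _≤_)
open import Data.Fin using (Fin)
open import Data.Vec using (Vec; []; _∷_; lookup)
open import Data.Bool using (Bool; true; false)
open import Data.List using (List; []; _∷_; _++_; [_])
open import Data.Product using (Σ; ∃; _×_; _,_; proj₁)
open import Data.Integer using (+_)
open import Data.Rational using (ℚ; _/_; 0ℚ; ∣_∣; _-_) renaming (_<_ to _<ℚ_)
open import Function.Bundles using (_↔_; Inverse)
open import Relation.Nullary using (¬_)
open import Relation.Binary.PropositionalEquality using (_≡_)

data PR : ℕ → Set where
  zeroF : ∀ {k} → PR k
  succF : PR 1
  proj  : ∀ {k} → Fin k → PR k
  comp  : ∀ {k m} → PR m → Vec (PR k) m → PR k
  prec  : ∀ {k} → PR k → PR (suc (suc k)) → PR (suc k)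
  mu    : ∀ {k} → PR (suc k) → PR k

mutual
  data _[_]⇓_ : ∀ {k} → PR k → Vec ℕ k → ℕ → Set where
    ev-zero : ∀ {k} {xs : Vec ℕ k} → zeroF [ xs ]⇓ 0
    ev-succ : ∀ {x} → succF [ x ∷ [] ]⇓ suc x
    ev-proj : ∀ {k} {i : Fin k} {xs} → proj i [ xs ]⇓ lookup xs i
    ev-comp : ∀ {k m} {f : PR m} {gs : Vec (PR k) m} {xs ys y} →
              gs [ xs ]⇓* ys → f [ ys ]⇓ y → comp f gs [ xs ]⇓ y
    ev-prec0 : ∀ {k} {g : PR k} {h} {xs y} →
               g [ xs ]⇓ y → prec g h [ 0 ∷ xs ]⇓ y
    ev-precS : ∀ {k} {g : PR k} {h} {n xs z y} →
               prec g h [ n ∷ xs ]⇓ z → h [ n ∷ z ∷ xs ]⇓ y →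
               prec g h [ suc n ∷ xs ]⇓ y
    ev-mu : ∀ {k} {f : PR (suc k)} {xs n} →
            f [ n ∷ xs ]⇓ 0 →
            (∀ i → i < n → Σ ℕ λ z → f [ i ∷ xs ]⇓ suc z) →
            mu f [ xs ]⇓ n

  data _[_]⇓*_ : ∀ {k m} → Vec (PR k) m → Vec ℕ k → Vec ℕ m → Set where
    ev-[] : ∀ {k} {xs : Vec ℕ k} → [] [ xs ]⇓* []
    ev-∷  : ∀ {k m} {g : PR k} {gs : Vec (PR k) m} {xs y ys} →
            g [ xs ]⇓ y → gs [ xs ]⇓* ys → (g ∷ gs) [ xs ]⇓* (y ∷ ys)

Computable : (ℕ → ℕ) → Set
Computable f = Σ (PR 1) λ e → ∀ n → e [ n ∷ [] ]⇓ f n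

tri : ℕ → ℕ
tri zero    = zero
tri (suc n) = suc n + tri n

pair : ℕ → ℕ → ℕ
pair a b = tri (a + b) + b

bit : Bool → ℕ
bit false = 0
bit true  = 1

code : List (ℕ × Bool) → ℕ
code []            = 0
code ((d , c) ∷ σ) = suc (pair (pair d (bit c)) (code σ))

Set⊆ω : Set
Set⊆ω = ℕ → Bool

count : Set⊆ω → ℕ → ℕ
count B zero    = 0
count B (suc n) with B n
... | true  = suc (count B n)
... | false = count B n

-- ρ_n(B) for n ≥ 1 (ρₙ B n is ρ_{n+1}(B))
ρₙ : Set⊆ω → ℕ → ℚ
ρₙ B n = (+ count B (suc n)) / suc n

DensityZero : Set⊆ω → Set
DensityZero B = ∀ (ε : ℚ) → 0ℚ <ℚ ε →
  ∃ λ N → ∀ n → N ≤ n → ∣ ρₙ B n - 0ℚ ∣ <ℚ ε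

image : ℕ ↔ ℕ → Set⊆ω → Set⊆ω
image π A m = A (Inverse.from π m)

IntrinsicallySmall : Set⊆ω → Set
IntrinsicallySmall A = ∀ (π : ℕ ↔ ℕ) → Computable (Inverse.to π) →
  DensityZero (image π A)

data IsSkipSeq : List (ℕ × Bool) → Set where
  ss-[] : IsSkipSeq []
  ss-1  : ∀ {d c} → IsSkipSeq ((d , c) ∷ [])
  ss-∷  : ∀ {d c d' c' σ} → d < d' → IsSkipSeq ((d' , c') ∷ σ) →
          IsSkipSeq ((d , c) ∷ (d' , c') ∷ σ)

IsSkipRule : (List (ℕ × Bool) → ℕ) → Set
IsSkipRule f = ∀ σ d c → IsSkipSeq (σ ++ [ (d , c) ]) → d < f (σ ++ [ (d , c) ])

ComputableSkipRule : (List (ℕ × Bool) → ℕ) → Set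
ComputableSkipRule f =
  IsSkipRule f × Σ (ℕ → ℕ) λ g → Computable g × (∀ σ → f σ ≡ g (code σ))

history : (List (ℕ × Bool) → ℕ) → Set⊆ω → ℕ → List (ℕ × Bool)
history f A zero    = []
history f A (suc n) = history f A n ++ [ (f (history f A n) , A (f (history f A n))) ]

selected : (List (ℕ × Bool) → ℕ) → Set⊆ω → ℕ → ℕ
selected f A n = f (history f A n)

applySkip : (List (ℕ × Bool) → ℕ) → Set⊆ω → Set⊆ω
applySkip f A n = A (selected f A n)

ZeroWeaklyStochastic : Set⊆ω → Set
ZeroWeaklyStochastic A = ∀ f → ComputableSkipRule f → DensityZero (applySkip f A)

{-# OPTIONS --safe #-}
module Submission where

-- The computable permutation reverses each interval [s , (s+1)²).  In a long enough interval
-- place windows of sizes s, s·r, s·r², ... so that larger windows lie further left; the reversal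
-- meets them in increasing order, so it detects a set that fills half of any single window.
-- Against N skip rules, examine which positions they would select if the interval contained
-- nothing of A.  If a rule selects a noticeable part of some window, then by the time it reaches any
-- window further right (and much smaller) it has made too many selections for that window to
-- matter.  So each rule is harmful for at most one window, and among N+1 windows there is one where
-- every rule either has already selected too much or selects only a few positions.  Put into A
-- all positions of that window except those few: at least half of the window is left, and the
-- rules of the second kind never see it.  Iterating along sparse intervals, with more and more
-- rules, gives A.

open import Defs
open import Level using (0ℓ)
open import Data.Product using (Σ; ∃; _×_; _,_; proj₁; proj₂)
open import Relation.Nullary using (¬_; Dec; yes; no; does; ¬?; contradiction)
open import Axiom.ExcludedMiddle using (ExcludedMiddle)
open import Algebra.Properties.CommutativeSemigroup using (x∙yz≈y∙xz)
open import Data.Bool using (Bool; true; false; not; _∧_)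
open import Data.Fin using (Fin; zero; suc; toℕ)
import Data.Fin.Properties as Finₚ
import Data.Integer as ℤ
import Data.Integer.Properties as ℤₚ
open import Data.List using (List; []; _∷_; _++_; [_]; map; concatMap; cartesianProductWith; allFin; upTo; length; lookup)
open import Data.List.Membership.Propositional using (_∈_)
open import Data.List.Membership.Propositional.Properties
  using (∈-++⁺ˡ; ∈-++⁺ʳ; ∈-map⁺; ∈-allFin; ∈-upTo⁺; ∈-concatMap⁺; ∈-cartesianProductWith⁺)
open import Data.List.Properties using (length-map)
open import Data.List.Relation.Unary.All as All using (All; []; _∷_; all?)
import Data.List.Relation.Unary.All.Properties as Allₚ
open import Data.List.Relation.Unary.Any as Any using (Any; here; there; any?)
open import Data.List.Relation.Unary.Any.Properties using (lookup-index)
open import Data.Nat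
open import Data.Nat.Coprimality using (1-coprimeTo)
open import Data.Nat.Properties
open import Data.Nat.Tactic.RingSolver using (solve-∀)
open import Data.Rational using (ℚ; mkℚ; *<*; 0ℚ; ∣_∣; toℚᵘ) renaming (_<_ to _<ℚ_; _-_ to _-ℚ_)
import Data.Rational.Properties as ℚₚ
import Data.Rational.Unnormalised as ℚᵘ
import Data.Rational.Unnormalised.Properties as ℚᵘₚ
open import Data.Sum using (_⊎_; inj₁; inj₂)
open import Data.Vec using (Vec; []; _∷_)
open import Function using (_∘_)
open import Function.Bundles using (_↔_; mk↔ₛ′)
open import Relation.Binary using (tri<; tri≈; tri>)
open import Relation.Binary.PropositionalEquality
  using (_≡_; refl; sym; trans; cong; cong₂; subst; subst₂; module ≡-Reasoning)
open import Relation.Unary using (Decidable)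

-- Determinism of evaluation.

mutual
  -- For `mu`, the smaller of two distinct results would be both a zero of `f` and a point where `f`
  -- is positive. Determinism later makes the rule computed by a program unique up to pointwise
  -- equality.
  ⇓-deterministic : ∀ {k} {e : PR k} {xs y z} → e [ xs ]⇓ y → e [ xs ]⇓ z → y ≡ z
  ⇓-deterministic ev-zero ev-zero = refl
  ⇓-deterministic ev-succ ev-succ = refl
  ⇓-deterministic ev-proj ev-proj = refl
  ⇓-deterministic (ev-comp gs f) (ev-comp gs′ f′) with refl ← ⇓*-deterministic gs gs′ =
    ⇓-deterministic f f′
  ⇓-deterministic (ev-prec0 g) (ev-prec0 g′) = ⇓-deterministic g g′
  ⇓-deterministic (ev-precS r h) (ev-precS r′ h′) with refl ← ⇓-deterministic r r′ =
    ⇓-deterministic h h′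
  ⇓-deterministic (ev-mu {n = m} f₀ f₊) (ev-mu {n = n} f₀′ f₊′) with <-cmp m n
  ... | tri≈ _ m≡n _ = m≡n
  ... | tri< m<n _ _ with _ , f₁ ← f₊′ m m<n = contradiction (⇓-deterministic f₀ f₁) λ ()
  ... | tri> _ _ n<m with _ , f₁ ← f₊ n n<m = contradiction (⇓-deterministic f₁ f₀′) λ ()

  ⇓*-deterministic : ∀ {k m} {es : Vec (PR k) m} {xs ys zs} →
    es [ xs ]⇓* ys → es [ xs ]⇓* zs → ys ≡ zs
  ⇓*-deterministic ev-[] ev-[] = refl
  ⇓*-deterministic (ev-∷ e es) (ev-∷ e′ es′) =
    cong₂ _∷_ (⇓-deterministic e e′) (⇓*-deterministic es es′)

-- Programs for arithmetic.

addᵖ : PR 2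
addᵖ = prec (proj zero) (comp succF (proj (suc zero) ∷ []))

addᵖ-⇓ : ∀ m n → addᵖ [ m ∷ n ∷ [] ]⇓ (m + n)
addᵖ-⇓ zero    n = ev-prec0 ev-proj
addᵖ-⇓ (suc m) n = ev-precS (addᵖ-⇓ m n) (ev-comp (ev-∷ ev-proj ev-[]) ev-succ)

mulᵖ : PR 2
mulᵖ = prec zeroF (comp addᵖ (proj (suc (suc zero)) ∷ proj (suc zero) ∷ []))

mulᵖ-⇓ : ∀ m n → mulᵖ [ m ∷ n ∷ [] ]⇓ (m * n)
mulᵖ-⇓ zero    n = ev-prec0 ev-zero
mulᵖ-⇓ (suc m) n =
  ev-precS (mulᵖ-⇓ m n) (ev-comp (ev-∷ ev-proj (ev-∷ ev-proj ev-[])) (addᵖ-⇓ n (m * n)))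

predᵖ : PR 1
predᵖ = prec zeroF (proj zero)

predᵖ-⇓ : ∀ n → predᵖ [ n ∷ [] ]⇓ pred n
predᵖ-⇓ zero    = ev-prec0 ev-zero
predᵖ-⇓ (suc n) = ev-precS (predᵖ-⇓ n) ev-proj

-- Recursion runs on the first argument, so the subtrahend comes first.
monusᵖ : PR 2
monusᵖ = prec (proj zero) (comp predᵖ (proj (suc zero) ∷ []))

monusᵖ-⇓ : ∀ m n → monusᵖ [ m ∷ n ∷ [] ]⇓ (n ∸ m)
monusᵖ-⇓ zero    n = ev-prec0 ev-proj
monusᵖ-⇓ (suc m) n = ev-precS (monusᵖ-⇓ m n) (ev-comp (ev-∷ ev-proj ev-[])
  (subst (predᵖ [ n ∸ m ∷ [] ]⇓_) (pred[m∸n]≡m∸[1+n] n m) (predᵖ-⇓ (n ∸ m))))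

ifZero : ℕ → ℕ → ℕ → ℕ
ifZero zero    a b = a
ifZero (suc _) a b = b

ifZeroᵖ : PR 3
ifZeroᵖ = prec (proj zero) (proj (suc (suc (suc zero))))

ifZeroᵖ-⇓ : ∀ c a b → ifZeroᵖ [ c ∷ a ∷ b ∷ [] ]⇓ ifZero c a b
ifZeroᵖ-⇓ zero    a b = ev-prec0 ev-proj
ifZeroᵖ-⇓ (suc c) a b = ev-precS (ifZeroᵖ-⇓ c a b) ev-proj

-- The computable permutation.

-- ℕ is cut into intervals [s , next s); start x is the left end of the one containing x.
next : ℕ → ℕ
next s = suc s * suc s

nextᵖ : PR 1
nextᵖ = comp mulᵖ (succF ∷ succF ∷ [])

nextᵖ-⇓ : ∀ s → nextᵖ [ s ∷ [] ]⇓ next s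
nextᵖ-⇓ s = ev-comp (ev-∷ ev-succ (ev-∷ ev-succ ev-[])) (mulᵖ-⇓ (suc s) (suc s))

start : ℕ → ℕ
start zero    = 0
start (suc x) = ifZero (next (start x) ∸ suc x) (suc x) (start x)

startᵖ : PR 1
startᵖ = prec zeroF (comp ifZeroᵖ
  (comp monusᵖ (comp succF (proj zero ∷ []) ∷ comp nextᵖ (proj (suc zero) ∷ []) ∷ [])
   ∷ comp succF (proj zero ∷ []) ∷ proj (suc zero) ∷ []))

startᵖ-⇓ : ∀ x → startᵖ [ x ∷ [] ]⇓ start x
startᵖ-⇓ zero    = ev-prec0 ev-zero
startᵖ-⇓ (suc x) = ev-precS (startᵖ-⇓ x) (ev-comp
  (ev-∷ (ev-comp (ev-∷ (ev-comp (ev-∷ ev-proj ev-[]) ev-succ)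
                 (ev-∷ (ev-comp (ev-∷ ev-proj ev-[]) (nextᵖ-⇓ _)) ev-[]))
                 (monusᵖ-⇓ (suc x) _))
  (ev-∷ (ev-comp (ev-∷ ev-proj ev-[]) ev-succ) (ev-∷ ev-proj ev-[])))
  (ifZeroᵖ-⇓ (next (start x) ∸ suc x) (suc x) (start x)))

-- reflect reverses each interval [s , next s).
reflect : ℕ → ℕ
reflect x = start x + (next (start x) ∸ suc x)

reflectᵖ : PR 1
reflectᵖ = comp addᵖ (startᵖ ∷ comp monusᵖ (succF ∷ comp nextᵖ (startᵖ ∷ []) ∷ []) ∷ [])

reflectᵖ-⇓ : ∀ x → reflectᵖ [ x ∷ [] ]⇓ reflect x
reflectᵖ-⇓ x = ev-comp (ev-∷ (startᵖ-⇓ x)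
  (ev-∷ (ev-comp (ev-∷ ev-succ (ev-∷ (ev-comp (ev-∷ (startᵖ-⇓ x) ev-[]) (nextᵖ-⇓ _)) ev-[]))
                 (monusᵖ-⇓ (suc x) _)) ev-[]))
  (addᵖ-⇓ (start x) _)

s<next : ∀ s → s < next s
s<next s = m≤m+n (suc s) (s * suc s)

start-bounds : ∀ x → start x ≤ x × x < next (start x)
start-bounds zero = z≤n , z<s
start-bounds (suc x) with next (start x) ∸ suc x in eq
... | zero  = ≤-refl , s<next (suc x)
... | suc d = m≤n⇒m≤1+n (proj₁ (start-bounds x)) ,
              m∸n≢0⇒n<m λ e → contradiction (trans (sym eq) e) λ ()

-- The hypothesis `start s ≡ s` expresses that `s` is the left end of an interval.
start-next : ∀ s → start s ≡ s → ∀ d → s + d < next s → start (s + d) ≡ s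
start-next s ss zero    _ = trans (cong start (+-identityʳ s)) ss
start-next s ss (suc d) p rewrite +-suc s d
  | start-next s ss d (<-trans (n<1+n (s + d)) p)
  with next s ∸ suc (s + d) in eq
... | zero  = contradiction (m∸n≡0⇒m≤n eq) (<⇒≱ p)
... | suc _ = refl

start-idem : ∀ x → start (start x) ≡ start x
start-idem zero = refl
start-idem (suc x) with next (start x) ∸ suc x in eq
... | zero  rewrite eq = refl
... | suc _ = start-idem x

-- Here `y` and `z` are the distances to the first and to the last point of the interval; reversal
-- exchanges them. The hypothesis is symmetric in `y` and `z`, so a second application gives
-- involutivity.
reflect-swap : ∀ s → start s ≡ s → ∀ y z → suc (s + y + z) ≡ next s → reflect (s + y) ≡ s + z
reflect-swap s ss y z eq = begin
  reflect (s + y)                    ≡⟨ cong (λ v → v + (next v ∸ suc (s + y)))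
                                          (start-next s ss y (subst (s + y <_) eq (s≤s (m≤m+n (s + y) z)))) ⟩
  s + (next s ∸ suc (s + y))         ≡⟨ cong (λ v → s + (v ∸ suc (s + y))) (sym eq) ⟩
  s + (suc (s + y) + z ∸ suc (s + y)) ≡⟨ cong (s +_) (m+n∸m≡n (suc (s + y)) z) ⟩
  s + z                              ∎
  where open ≡-Reasoning

reflect-involutive : ∀ x → reflect (reflect x) ≡ x
reflect-involutive x = begin
  reflect (reflect x)       ≡⟨ cong (λ v → reflect (reflect v)) (sym s+y≡x) ⟩
  reflect (reflect (s + y)) ≡⟨ cong reflect (reflect-swap s ss y z eq) ⟩
  reflect (s + z)           ≡⟨ reflect-swap s ss z y (trans (cong suc (swap s z y)) eq) ⟩
  s + y                     ≡⟨ s+y≡x ⟩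
  x                         ∎
  where
  open ≡-Reasoning
  s = start x
  ss : start s ≡ s
  ss = start-idem x
  y = x ∸ s
  z = next s ∸ suc x
  s+y≡x : s + y ≡ x
  s+y≡x = m+[n∸m]≡n (proj₁ (start-bounds x))
  eq : suc (s + y + z) ≡ next s
  eq = trans (cong (λ v → suc (v + z)) s+y≡x) (m+[n∸m]≡n (proj₂ (start-bounds x)))
  swap : ∀ a b c → a + b + c ≡ a + c + b
  swap = solve-∀

reflection : ℕ ↔ ℕ
reflection = mk↔ₛ′ reflect reflect reflect-involutive reflect-involutive

next-start : ∀ s → start s ≡ s → start (next s) ≡ next s
next-start s ss = begin
  start (next s)                                  ≡⟨⟩
  ifZero (next (start p) ∸ next s) (next s) (start p) ≡⟨ cong (λ v → ifZero (next v ∸ next s) (next s) v) start-p ⟩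
  ifZero (next s ∸ next s) (next s) s             ≡⟨ cong (λ v → ifZero v (next s) s) (n∸n≡0 (next s)) ⟩
  next s                                          ∎
  where
  open ≡-Reasoning
  -- The last point of the interval of `s`: `suc p` is `next s` by computation.
  p = s + s * suc s
  start-p : start p ≡ s
  start-p = start-next s ss (s * suc s) ≤-refl

large-start : ∀ n → ∃ λ s → n ≤ s × start s ≡ s
large-start zero = 0 , z≤n , refl
large-start (suc n) with s , n≤s , ss ← large-start n =
  next s , ≤-trans (s≤s n≤s) (s<next s) , next-start s ss

-- Enumeration of all programs.

vecs : ∀ {A : Set} → List A → ∀ m → List (Vec A m)
vecs as zero    = [ [] ]
vecs as (suc m) = cartesianProductWith _∷_ as (vecs as m)

module _ (T : ∀ k → List (PR k)) where
  succs : ∀ k → List (PR k)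
  succs 1 = [ succF ]
  succs _ = []

  comps : ℕ → ∀ k → List (PR k)
  comps d k = concatMap (λ m → cartesianProductWith comp (T m) (vecs (T k) m)) (upTo d)

  precs : ∀ k → List (PR k)
  precs zero    = []
  precs (suc k) = cartesianProductWith prec (T k) (T (suc (suc k)))

-- The stage `d` bounds both the nesting depth and, through `upTo d`, the intermediate arity of a
-- composition; this keeps each list finite.
terms : ℕ → ∀ k → List (PR k)
terms zero    k = []
terms (suc d) k = zeroF ∷ succs (terms d) k ++ map proj (allFin k) ++ comps (terms d) d k
                    ++ precs (terms d) k ++ map mu (terms d (suc k))

mutual
  -- Asking for membership at every stage from `n` on lets the bounds of subterms be combined by a
  -- maximum.
  terms-complete : ∀ {k} (e : PR k) → ∃ λ n → ∀ d → n ≤ d → e ∈ terms d k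
  terms-complete zeroF = 1 , λ { (suc d) _ → here refl }
  terms-complete succF = 1 , λ { (suc d) _ → there (here refl) }
  terms-complete {k} (proj i) = 1 , λ { (suc d) _ →
    there (∈-++⁺ʳ (succs (terms d) k) (∈-++⁺ˡ (∈-map⁺ proj (∈-allFin i)))) }
  terms-complete {k} (comp {m = m} f gs)
    with n , f∈ ← terms-complete f | o , gs∈ ← vecs-complete gs =
    -- The term `suc m` guarantees that the intermediate arity `m` occurs in `upTo d`.
    suc (suc m ⊔ (n ⊔ o)) , λ { (suc d) (s≤s p) →
    there (∈-++⁺ʳ (succs (terms d) k) (∈-++⁺ʳ (map proj (allFin k)) (∈-++⁺ˡ
      (∈-concatMap⁺ _ (Any.map (λ { refl → ∈-cartesianProductWith⁺ comp
        (f∈ d (m⊔n≤o⇒m≤o n o (m⊔n≤o⇒n≤o (suc m) (n ⊔ o) p)))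
        (gs∈ d (m⊔n≤o⇒n≤o n o (m⊔n≤o⇒n≤o (suc m) (n ⊔ o) p))) })
        (∈-upTo⁺ (m⊔n≤o⇒m≤o (suc m) (n ⊔ o) p))))))) }
  terms-complete {suc k} (prec g h)
    with n , g∈ ← terms-complete g | o , h∈ ← terms-complete h =
    suc (n ⊔ o) , λ { (suc d) (s≤s p) →
    there (∈-++⁺ʳ (succs (terms d) (suc k)) (∈-++⁺ʳ (map proj (allFin (suc k)))
      (∈-++⁺ʳ (comps (terms d) d (suc k)) (∈-++⁺ˡ (∈-cartesianProductWith⁺ prec
        (g∈ d (m⊔n≤o⇒m≤o n o p)) (h∈ d (m⊔n≤o⇒n≤o n o p))))))) }
  terms-complete {k} (mu f) with n , f∈ ← terms-complete f =
    suc n , λ { (suc d) (s≤s p) →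
    there (∈-++⁺ʳ (succs (terms d) k) (∈-++⁺ʳ (map proj (allFin k))
      (∈-++⁺ʳ (comps (terms d) d k) (∈-++⁺ʳ (precs (terms d) k) (∈-map⁺ mu (f∈ d p)))))) }

  vecs-complete : ∀ {k m} (es : Vec (PR k) m) → ∃ λ n → ∀ d → n ≤ d → es ∈ vecs (terms d k) m
  vecs-complete [] = 0 , λ _ _ → here refl
  vecs-complete (e ∷ es) with n , e∈ ← terms-complete e | o , es∈ ← vecs-complete es =
    n ⊔ o , λ d p → ∈-cartesianProductWith⁺ _∷_
      (e∈ d (m⊔n≤o⇒m≤o n o p)) (es∈ d (m⊔n≤o⇒n≤o n o p))

-- Skip rules and their runs.

SkipRule : Set
SkipRule = Σ (List (ℕ × Bool) → ℕ) IsSkipRule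

-- A placeholder for programs that compute no skip rule. Summing the successors of all positions
-- exceeds each of them.
defaultRule : SkipRule
defaultRule = f , λ σ d c _ → bound σ d c
  where
  f : List (ℕ × Bool) → ℕ
  f []            = 0
  f ((d , _) ∷ σ) = suc d + f σ
  bound : ∀ σ d c → d < f (σ ++ [ (d , c) ])
  bound []            d c = m≤m+n (suc d) 0
  bound ((e , _) ∷ σ) d c = ≤-trans (bound σ d c) (m≤n+m _ (suc e))

IsSkipSeq-∷ʳ : ∀ σ {d c d′ c′} → IsSkipSeq (σ ++ [ (d , c) ]) → d < d′ →
  IsSkipSeq ((σ ++ [ (d , c) ]) ++ [ (d′ , c′) ])
IsSkipSeq-∷ʳ []          _           d<d′ = ss-∷ d<d′ ss-1
IsSkipSeq-∷ʳ (_ ∷ [])    (ss-∷ lt s) d<d′ = ss-∷ lt (IsSkipSeq-∷ʳ [] s d<d′)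
IsSkipSeq-∷ʳ (_ ∷ x ∷ σ) (ss-∷ lt s) d<d′ = ss-∷ lt (IsSkipSeq-∷ʳ (x ∷ σ) s d<d′)

module _ (f : List (ℕ × Bool) → ℕ) (rule : IsSkipRule f) (B : Set⊆ω) where
  -- A skip rule is constrained on skip sequences only, so its growth along a run depends on this.
  history-isSkipSeq : ∀ n → IsSkipSeq (history f B (suc n))
  history-isSkipSeq zero    = ss-1
  history-isSkipSeq (suc n) =
    IsSkipSeq-∷ʳ (history f B n) (history-isSkipSeq n) (rule _ _ _ (history-isSkipSeq n))

  selected-suc : ∀ n → selected f B n < selected f B (suc n)
  selected-suc n = rule _ _ _ (history-isSkipSeq n)

  selected-mono : ∀ {m n} → m < n → selected f B m < selected f B n
  selected-mono {m} {suc n} (s≤s m≤n) with m≤n⇒m<n∨m≡n m≤n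
  ... | inj₁ m<n  = <-trans (selected-mono m<n) (selected-suc n)
  ... | inj₂ refl = selected-suc n

history-ext : ∀ {f g : List (ℕ × Bool) → ℕ} → (∀ σ → f σ ≡ g σ) → ∀ B n → history f B n ≡ history g B n
history-ext f≗g B zero = refl
history-ext {f} {g} f≗g B (suc n)
  rewrite history-ext f≗g B n | f≗g (history g B n) = refl

-- A rule learns a set only at the positions it selects, so a change elsewhere leaves the run as it
-- was.
history-agree : ∀ f (B C : Set⊆ω) w → (∀ t → t < w → C (selected f B t) ≡ B (selected f B t)) →
  ∀ t → t ≤ w → history f C t ≡ history f B t
history-agree f B C w p zero    _ = refl
history-agree f B C w p (suc t) t<w
  rewrite history-agree f B C w p t (<⇒≤ t<w) | p t t<w = refl

-- Counting elements below a bound.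

bit≤1 : ∀ b → bit b ≤ 1
bit≤1 false = z≤n
bit≤1 true  = ≤-refl

count-suc : ∀ B n → count B (suc n) ≡ bit (B n) + count B n
count-suc B n with B n
... | true  = refl
... | false = refl

count-cong : ∀ {B C : Set⊆ω} n → (∀ x → x < n → B x ≡ C x) → count B n ≡ count C n
count-cong zero    p = refl
count-cong {B} {C} (suc n) p
  rewrite count-suc B n | count-suc C n | p n ≤-refl
  = cong (bit (C n) +_) (count-cong n λ x x<n → p x (m<n⇒m<1+n x<n))

bit-mono : ∀ {b c} → (b ≡ true → c ≡ true) → bit b ≤ bit c
bit-mono {false} p = z≤n
bit-mono {true}  p rewrite p refl = ≤-refl

count-mono : ∀ {B C : Set⊆ω} n → (∀ x → x < n → B x ≡ true → C x ≡ true) → count B n ≤ count C n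
count-mono zero    p = z≤n
count-mono {B} {C} (suc n) p
  rewrite count-suc B n | count-suc C n
  = +-mono-≤ (bit-mono (p n ≤-refl)) (count-mono n λ x x<n → p x (m<n⇒m<1+n x<n))

count-+ : ∀ B m n → count B (m + n) ≡ count B m + count (λ x → B (m + x)) n
count-+ B m zero    = trans (cong (count B) (+-identityʳ m)) (sym (+-identityʳ (count B m)))
count-+ B m (suc n) = begin
  count B (m + suc n)                                  ≡⟨ cong (count B) (+-suc m n) ⟩
  count B (suc (m + n))                                ≡⟨ count-suc B (m + n) ⟩
  bit (B (m + n)) + count B (m + n)                    ≡⟨ cong (bit (B (m + n)) +_) (count-+ B m n) ⟩
  bit (B (m + n)) + (count B m + count C n)            ≡⟨ x∙yz≈y∙xz +-commutativeSemigroup (bit (B (m + n))) (count B m) (count C n) ⟩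
  count B m + (bit (B (m + n)) + count C n)            ≡⟨ cong (count B m +_) (sym (count-suc C n)) ⟩
  count B m + count C (suc n)                          ∎
  where
  open ≡-Reasoning
  C : Set⊆ω
  C x = B (m + x)

count-≤ : ∀ B n → count B n ≤ n
count-≤ B zero    = z≤n
count-≤ B (suc n) rewrite count-suc B n = +-mono-≤ (bit≤1 (B n)) (count-≤ B n)

count-empty : ∀ {B : Set⊆ω} n → (∀ x → x < n → B x ≡ false) → count B n ≡ 0
count-empty zero    p = refl
count-empty {B} (suc n) p
  rewrite count-suc B n | p n ≤-refl = count-empty n λ x x<n → p x (m<n⇒m<1+n x<n)

count-mono-≤ : ∀ B {m n} → m ≤ n → count B m ≤ count B n
count-mono-≤ B {m} m≤n with k , refl ← m≤n⇒∃[o]m+o≡n m≤n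
  rewrite count-+ B m k = m≤m+n _ _

count-gap : ∀ B {m n} → m ≤ n → (∀ x → m ≤ x → x < n → B x ≡ false) → count B n ≡ count B m
count-gap B {m} m≤n p with k , refl ← m≤n⇒∃[o]m+o≡n m≤n = begin
  count B (m + k)                             ≡⟨ count-+ B m k ⟩
  count B m + count (λ x → B (m + x)) k       ≡⟨ cong (count B m +_) (count-empty k λ x x<k → p (m + x) (m≤m+n m x) (+-monoʳ-< m x<k)) ⟩
  count B m + 0                               ≡⟨ +-identityʳ _ ⟩
  count B m                                   ∎
  where open ≡-Reasoning

count-bounded : ∀ B {b} → (∀ x → b ≤ x → B x ≡ false) → ∀ n → count B n ≤ b
count-bounded B {b} p n with ≤-total n b
... | inj₁ n≤b = ≤-trans (count-≤ B n) n≤b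
... | inj₂ b≤n rewrite count-gap B b≤n (λ x b≤x _ → p x b≤x) = count-≤ B b

count-reverse : ∀ B n → count (λ x → B (n ∸ suc x)) n ≡ count B n
count-reverse B zero    = refl
count-reverse B (suc n) = begin
  count (λ x → B (n ∸ x)) (suc n)                       ≡⟨ count-suc (λ x → B (n ∸ x)) n ⟩
  bit (B (n ∸ n)) + count (λ x → B (n ∸ x)) n           ≡⟨ cong₂ (λ u v → bit (B u) + v) (n∸n≡0 n)
                                                            (count-cong n λ x x<n → cong B (sym (suc[n∸1+x] x<n))) ⟩
  bit (B 0) + count (λ x → B (suc (n ∸ suc x))) n       ≡⟨ cong (bit (B 0) +_) (count-reverse (B ∘ suc) n) ⟩
  bit (B 0) + count (B ∘ suc) n                         ≡⟨ cong (_+ count (B ∘ suc) n) (sym (trans (count-suc B 0) (+-identityʳ _))) ⟩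
  count B 1 + count (B ∘ suc) n                         ≡⟨ sym (count-+ B 1 n) ⟩
  count B (suc n)                                       ∎
  where
  open ≡-Reasoning
  suc[n∸1+x] : ∀ {n x} → x < n → suc (n ∸ suc x) ≡ n ∸ x
  suc[n∸1+x] {n} x<n = sym (+-∸-assoc 1 x<n)

-- Removing finitely many thin sets.

avoid : List Set⊆ω → Set⊆ω
avoid []       x = true
avoid (Z ∷ Zs) x = not (Z x) ∧ avoid Zs x

avoid-∈ : ∀ {Z Zs x} → Z ∈ Zs → Z x ≡ true → avoid Zs x ≡ false
avoid-∈ (here refl) Zx rewrite Zx = refl
avoid-∈ {Zs = Y ∷ Zs} {x} (there Z∈) Zx with Y x
... | true  = refl
... | false = avoid-∈ Z∈ Zx

count-diff : ∀ (Y Z : Set⊆ω) n → count Z n ≤ count (λ x → not (Y x) ∧ Z x) n + count Y n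
count-diff Y Z zero = z≤n
count-diff Y Z (suc n) with Y n | Z n
... | true  | true  = ≤-trans (s≤s (count-diff Y Z n)) (≤-reflexive (sym (+-suc _ _)))
... | true  | false = ≤-trans (count-diff Y Z n) (+-monoʳ-≤ _ (n≤1+n _))
... | false | true  = s≤s (count-diff Y Z n)
... | false | false = count-diff Y Z n

-- The union bound, with densities at most `1/c` multiplied out to stay in `ℕ`.
count-avoid : ∀ c n Zs → All (λ Z → c * count Z n ≤ n) Zs →
  c * n ≤ c * count (avoid Zs) n + length Zs * n
count-avoid c n [] [] = ≤-reflexive (trans (cong (c *_) (sym (count-full n))) (sym (+-identityʳ _)))
  where
  count-full : ∀ n → count (avoid []) n ≡ n
  count-full zero    = refl
  count-full (suc n) = cong suc (count-full n)
count-avoid c n (Z ∷ Zs) (z ∷ zs) = begin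
  c * n                                            ≤⟨ count-avoid c n Zs zs ⟩
  c * count (avoid Zs) n + l                       ≤⟨ +-monoˡ-≤ l (*-monoʳ-≤ c (count-diff Z (avoid Zs) n)) ⟩
  c * (x + count Z n) + l                          ≡⟨ shuffle c x (count Z n) l ⟩
  c * x + (c * count Z n + l)                      ≤⟨ +-monoʳ-≤ (c * x) (+-monoˡ-≤ l z) ⟩
  c * x + (n + l)                                  ∎
  where
  open ≤-Reasoning
  x = count (avoid (Z ∷ Zs)) n
  l = length Zs * n
  shuffle : ∀ c x y l → c * (x + y) + l ≡ c * x + (c * y + l)
  shuffle = solve-∀

-- With `N` sets of density at most `1/(2(N+1))`, the union has density below one half.
avoid-half : ∀ Zs n → All (λ Z → (2 * suc (length Zs)) * count Z n ≤ n) Zs → n ≤ 2 * count (avoid Zs) n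
avoid-half Zs n zs = *-cancelˡ-≤ (suc N) (+-cancelʳ-≤ (suc N * n) _ _ (begin
  suc N * n + suc N * n         ≡⟨ double (suc N) n ⟩
  (2 * suc N) * n               ≤⟨ count-avoid (2 * suc N) n Zs zs ⟩
  (2 * suc N) * x + N * n       ≤⟨ +-monoʳ-≤ _ (*-monoˡ-≤ n (n≤1+n N)) ⟩
  (2 * suc N) * x + suc N * n   ≡⟨ cong (_+ suc N * n) (swap (suc N) x) ⟩
  suc N * (2 * x) + suc N * n   ∎))
  where
  open ≤-Reasoning
  N = length Zs
  x = count (avoid Zs) n
  double : ∀ m n → m * n + m * n ≡ (2 * m) * n
  double = solve-∀
  swap : ∀ m n → (2 * m) * n ≡ m * (2 * n)
  swap = solve-∀

-- Pigeonhole: if each of the first `length xs + 1` indices had a bad element, two indices would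
-- share one, against the hypothesis that an element is bad at most once.
all-good-somewhere : ∀ {X : Set} (xs : List X) {Bad : ℕ → X → Set} → (∀ j → Decidable (Bad j)) →
  (∀ {i j x} → i < j → Bad i x → ¬ Bad j x) →
  ∃ λ j → j ≤ length xs × All (¬_ ∘ Bad j) xs
all-good-somewhere xs {Bad} bad? once
  with Finₚ.any? {n = suc (length xs)} (λ i → all? (¬? ∘ bad? (toℕ i)) xs)
... | yes (i , good) = toℕ i , s≤s⁻¹ (Finₚ.toℕ<n i) , good
... | no none = contradiction (lookup-index (bad-at j))
      (subst (λ k → ¬ Bad (toℕ j) (lookup xs k)) eq (once i<j (lookup-index (bad-at i))))
  where
  bad-at : ∀ (i : Fin (suc (length xs))) → Any (Bad (toℕ i)) xs
  bad-at i with any? (bad? (toℕ i)) xs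
  ... | yes p = p
  ... | no ¬p = contradiction (i , Allₚ.¬Any⇒All¬ xs ¬p) none
  repetition = Finₚ.pigeonhole ≤-refl (Any.index ∘ bad-at)
  i   = proj₁ repetition
  j   = proj₁ (proj₂ repetition)
  i<j = proj₁ (proj₂ (proj₂ repetition))
  eq  = proj₂ (proj₂ (proj₂ repetition))

-- Hits along a run.

applySkip-agree : ∀ f (B C : Set⊆ω) w → (∀ t → t < w → C (selected f B t) ≡ B (selected f B t)) →
  ∀ t → t ≤ w → count (applySkip f C) t ≡ count (applySkip f B) t
applySkip-agree f B C w p t t≤w = count-cong t λ x x<t →
  trans (cong (C ∘ f) (history-agree f B C w p x (<⇒≤ (<-≤-trans x<t t≤w)))) (p x (<-≤-trans x<t t≤w))

-- Selections increase strictly, so distinct hits are distinct elements of `B` below the next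
-- selection.
count-applySkip : ∀ f → IsSkipRule f → ∀ B t → count (applySkip f B) t ≤ count B (selected f B t)
count-applySkip f rule B zero    = z≤n
count-applySkip f rule B (suc t) = begin
  count (applySkip f B) (suc t)              ≡⟨ count-suc (applySkip f B) t ⟩
  bit (B d) + count (applySkip f B) t        ≤⟨ +-monoʳ-≤ (bit (B d)) (count-applySkip f rule B t) ⟩
  bit (B d) + count B d                      ≡⟨ sym (count-suc B d) ⟩
  count B (suc d)                            ≤⟨ count-mono-≤ B (selected-suc f rule B t) ⟩
  count B (selected f B (suc t))             ∎
  where
  open ≤-Reasoning
  d = selected f B t

selected-bounded : ∀ (L : List SkipRule) B T →
  ∃ λ S → ∀ {f} → f ∈ L → ∀ t → t < T → selected (proj₁ f) B t < S
selected-bounded []      B T = 0 , λ ()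
selected-bounded ((f , rule) ∷ L) B T with S , p ← selected-bounded L B T =
  selected f B T + S , λ where
    (here refl) t t<T → <-≤-trans (selected-mono f rule B t<T) (m≤m+n _ S)
    (there f∈)  t t<T → <-≤-trans (p f∈ t t<T) (m≤n+m S _)

-- One stage of the construction. `sparse` holds at all times from `time` on, but for the set of
-- this stage only; `early` at the following stage carries it over to the limit until the time of
-- that stage, when the next estimate takes over.
record Extension (B : Set⊆ω) (b : ℕ) (L : List SkipRule) (q : ℕ) : Set where
  field
    set               : Set⊆ω
    cutoff end time   : ℕ
    b≤cutoff          : b ≤ cutoff
    cutoff<end        : cutoff < end
    q≤time            : q ≤ time
    agree             : ∀ x → x < cutoff → set x ≡ B x
    empty             : ∀ x → end ≤ x → set x ≡ false
    early             : ∀ {f} → f ∈ L → ∀ t → t < time → selected (proj₁ f) B t < cutoff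
    sparse            : ∀ {f} → f ∈ L → ∀ t → time ≤ t → q * count (applySkip (proj₁ f) set) t ≤ t + t
    dense             : ∃ λ n → q ≤ n × n ≤ 6 * count (image reflection set) n

-- Filling one window.

module _ (em : ExcludedMiddle 0ℓ) where

  Sampled : Set⊆ω → SkipRule → Set⊆ω
  Sampled B (f , _) x = does (em {∃ λ t → selected f B t ≡ x})

  sampled-selected : ∀ B F t → Sampled B F (selected (proj₁ F) B t) ≡ true
  sampled-selected B (f , _) t with em {∃ λ t′ → selected f B t′ ≡ selected f B t}
  ... | yes _ = refl
  ... | no ¬p = contradiction (t , refl) ¬p

  unsampled : ∀ B F x → (∀ t → ¬ (selected (proj₁ F) B t ≡ x)) → Sampled B F x ≡ false
  unsampled B (f , _) x p with em {∃ λ t → selected f B t ≡ x}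
  ... | yes (t , eq) = contradiction eq (p t)
  ... | no _ = refl

  -- Only the selections numbered `0` to `t - 1` lie below selection number `t`.
  count-sampled : ∀ B F t {x} → x ≤ selected (proj₁ F) B t → count (Sampled B F) x ≤ t
  count-sampled B F@(f , rule) zero {x} x≤d = ≤-reflexive (count-empty x λ y y<x → unsampled B F y λ where
    zero    eq → <-irrefl (sym eq) (<-≤-trans y<x x≤d)
    (suc t) eq → <-irrefl (sym eq) (<-trans (<-≤-trans y<x x≤d) (selected-mono f rule B {0} {suc t} z<s)))
  count-sampled B F@(f , rule) (suc t) {x} x≤d = begin
    count Z x                            ≤⟨ count-mono-≤ Z x≤d ⟩
    count Z (selected f B (suc t))       ≡⟨ count-gap Z (selected-suc f rule B t) (λ y lo hi → unsampled B F y (gap lo hi)) ⟩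
    count Z (suc (selected f B t))       ≡⟨ count-suc Z (selected f B t) ⟩
    bit (Z (selected f B t)) + count Z (selected f B t) ≤⟨ +-mono-≤ (bit≤1 _) (count-sampled B F t ≤-refl) ⟩
    suc t ∎
    where
    open ≤-Reasoning
    Z = Sampled B F
    gap : ∀ {y} → selected f B t < y → y < selected f B (suc t) → ∀ t′ → ¬ (selected f B t′ ≡ y)
    gap lo hi t′ refl with <-≤-connex t t′
    ... | inj₂ t′≤t with m≤n⇒m<n∨m≡n t′≤t
    ...   | inj₁ t′<t = <-asym lo (selected-mono f rule B t′<t)
    ...   | inj₂ refl = <-irrefl refl lo
    gap lo hi t′ refl | inj₁ t<t′ with m≤n⇒m<n∨m≡n t<t′
    ...   | inj₁ lt = <-asym hi (selected-mono f rule B lt)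
    ...   | inj₂ refl = <-irrefl refl hi

  module Window (B : Set⊆ω) (L : List SkipRule) (q : ℕ) where
    -- Both concern the window from `a` to `a + u`. The samples of a light rule can be removed from
    -- it cheaply; a spent rule arrives so late that `u` more hits have frequency at most `1/q`.
    Light Spent : ℕ → ℕ → SkipRule → Set
    Light a u F = (2 * suc (length L)) * count (λ y → Sampled B F (a + y)) u ≤ u
    Spent a u F = q * u ≤ count (Sampled B F) a

    light? : ∀ a u F → Dec (Light a u F)
    light? a u F = em

    -- Empty for a rule that is not light, so that every set removed from the window is thin.
    hidden : ℕ → ℕ → SkipRule → Set⊆ω
    hidden a u F y = does (light? a u F) ∧ Sampled B F (a + y)

    fresh : ℕ → ℕ → Set⊆ω
    fresh a u = avoid (map (hidden a u) L)

    fresh-half : ∀ a u → u ≤ 2 * count (fresh a u) u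
    fresh-half a u = avoid-half (map (hidden a u) L) u
      (subst (λ l → All (λ Z → (2 * suc l) * count Z u ≤ u) (map (hidden a u) L))
        (sym (length-map (hidden a u) L))
        (Allₚ.map⁺ (All.universal hidden-light L)))
      where
      hidden-light : ∀ F → (2 * suc (length L)) * count (hidden a u F) u ≤ u
      hidden-light F with light? a u F
      ... | yes p = p
      ... | no _ rewrite count-empty {λ _ → false} u (λ _ _ → refl) | *-zeroʳ (2 * suc (length L)) = z≤n

    fresh-sampled : ∀ {a u F y} → F ∈ L → Light a u F → Sampled B F (a + y) ≡ true → fresh a u y ≡ false
    fresh-sampled {a} {u} {F} {y} F∈ l eq = avoid-∈ (∈-map⁺ (hidden a u) F∈) (h l eq)
      where
      h : Light a u F → Sampled B F (a + y) ≡ true → hidden a u F y ≡ true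
      h l eq with light? a u F
      ... | yes _ = eq
      ... | no ¬l = contradiction l ¬l

    -- The window is followed by `u` free cells up to the end of the interval, so reversal moves it
    -- onto the cells from `s + u` to `s + 2u`.
    module Fill (s a u b : ℕ) (B-empty : ∀ x → b ≤ x → B x ≡ false)
      (b≤s : b ≤ s) (s≤a : s ≤ a) (s≤u : s ≤ u) (ss : start s ≡ s)
      (a+2u : a + (u + u) ≡ next s)
      (choice : ∀ {F} → F ∈ L → Light a u F ⊎ Spent a u F) where

      set : Set⊆ω
      set x with x <? a | x <? a + u
      ... | yes _ | _     = B x
      ... | no _  | yes _ = fresh a u (x ∸ a)
      ... | no _  | no _  = false

      set-below : ∀ x → x < a → set x ≡ B x
      set-below x x<a with x <? a | x <? a + u
      ... | yes _ | _ = refl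
      ... | no ¬p | _ = contradiction x<a ¬p

      set-inside : ∀ y → y < u → set (a + y) ≡ fresh a u y
      set-inside y y<u with a + y <? a | a + y <? a + u
      ... | yes p | _     = contradiction p (m+n≮m a y)
      ... | no _  | yes _ = cong (fresh a u) (m+n∸m≡n a y)
      ... | no _  | no ¬p = contradiction (+-monoʳ-< a y<u) ¬p

      set-above : ∀ x → a + u ≤ x → set x ≡ false
      set-above x p with x <? a | x <? a + u
      ... | yes q | _     = contradiction q (≤⇒≯ (m+n≤o⇒m≤o a p))
      ... | no _  | yes q = contradiction q (≤⇒≯ p)
      ... | no _  | no _  = refl

      count-set : ∀ x → count set x ≤ b + u
      count-set x = begin
        count set x                                   ≤⟨ count-mono-≤ set (m≤n+m x (a + u)) ⟩
        count set (a + u + x)                         ≡⟨ count-gap set (m≤m+n (a + u) x) (λ y p _ → set-above y p) ⟩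
        count set (a + u)                             ≡⟨ count-+ set a u ⟩
        count set a + count (λ y → set (a + y)) u     ≤⟨ +-mono-≤ (≤-reflexive (count-cong a set-below)) (count-≤ _ u) ⟩
        count B a + u                                 ≤⟨ +-monoˡ-≤ u (count-bounded B B-empty a) ⟩
        b + u                                         ∎
        where open ≤-Reasoning

      B-above : ∀ x → a ≤ x → B x ≡ false
      B-above x a≤x = B-empty x (≤-trans b≤s (≤-trans s≤a a≤x))

      -- What the run on `B` selects inside the window was removed from it, and `B` itself is empty
      -- there; so the run cannot tell `set` from `B`.
      light-agree : ∀ {F} → F ∈ L → Light a u F → ∀ t →
        set (selected (proj₁ F) B t) ≡ B (selected (proj₁ F) B t)
      light-agree {F} F∈ l t with selected (proj₁ F) B t | sampled-selected B F t
      ... | d | sampled with <-≤-connex d a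
      ...   | inj₁ d<a = set-below d d<a
      ...   | inj₂ a≤d with y , refl ← m≤n⇒∃[o]m+o≡n a≤d with <-≤-connex y u
      ...     | inj₁ y<u = trans (set-inside y y<u) (trans (fresh-sampled F∈ l sampled) (sym (B-above d a≤d)))
      ...     | inj₂ u≤y = trans (set-above d (+-monoʳ-≤ a u≤y)) (sym (B-above d a≤d))

      spent-below : ∀ {F} → Spent a u F → ∀ t → t < q * u → selected (proj₁ F) B t < a
      spent-below {F} sp t t<w = ≰⇒> λ a≤d → <⇒≱ t<w (≤-trans sp (count-sampled B F t a≤d))

      unchanged-bound : ∀ F t w → t ≤ w →
        (∀ t → t < w → set (selected (proj₁ F) B t) ≡ B (selected (proj₁ F) B t)) →
        count (applySkip (proj₁ F) set) t ≤ b
      unchanged-bound (f , rule) t w t≤w p = begin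
        count (applySkip f set) t    ≡⟨ applySkip-agree f B set w p t t≤w ⟩
        count (applySkip f B) t      ≤⟨ count-applySkip f rule B t ⟩
        count B (selected f B t)     ≤⟨ count-bounded B B-empty (selected f B t) ⟩
        b                            ∎
        where open ≤-Reasoning

      -- A light rule hits only elements of `B`, at most `b` of them. So does a spent rule before
      -- time `q * u`; afterwards `q * b` and `q * u` are each at most `t`, whence `t + t`.
      set-sparse : ∀ {F} → F ∈ L → ∀ t → q * b ≤ t → q * count (applySkip (proj₁ F) set) t ≤ t + t
      set-sparse {F@(f , rule)} F∈ t qb≤t with choice F∈
      ... | inj₁ l = ≤-trans (*-monoʳ-≤ q (unchanged-bound F t t ≤-refl λ t _ → light-agree F∈ l t))
                             (≤-trans qb≤t (m≤m+n t t))
      ... | inj₂ sp with ≤-total t (q * u)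
      ...   | inj₁ t≤w = ≤-trans (*-monoʳ-≤ q (unchanged-bound F t (q * u) t≤w
                                   λ t t<w → set-below _ (spent-below {F} sp t t<w)))
                                 (≤-trans qb≤t (m≤m+n t t))
      ...   | inj₂ w≤t = begin
        q * count (applySkip f set) t          ≤⟨ *-monoʳ-≤ q (count-applySkip f rule set t) ⟩
        q * count set (selected f set t)       ≤⟨ *-monoʳ-≤ q (count-set (selected f set t)) ⟩
        q * (b + u)                            ≡⟨ *-distribˡ-+ q b u ⟩
        q * b + q * u                          ≤⟨ +-mono-≤ qb≤t w≤t ⟩
        t + t                                  ∎
        where open ≤-Reasoning

      reflect-window : ∀ y → y < u → reflect (s + u + y) ≡ a + (u ∸ suc y)
      reflect-window y y<u
        with z , refl ← m≤n⇒∃[o]m+o≡n y<u | k , refl ← m≤n⇒∃[o]m+o≡n s≤a = begin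
        reflect (s + u + y)      ≡⟨ cong reflect (+-assoc s u y) ⟩
        reflect (s + (u + y))    ≡⟨ reflect-swap s ss (u + y) (k + z) (trans (arith s y z k) a+2u) ⟩
        s + (k + z)              ≡⟨ sym (+-assoc s k z) ⟩
        s + k + z                ≡⟨ cong (s + k +_) (sym (m+n∸m≡n y z)) ⟩
        s + k + (suc y + z ∸ suc y) ∎
        where
        open ≡-Reasoning
        arith : ∀ s y z k → suc (s + (suc y + z + y) + (k + z)) ≡ s + k + (suc y + z + (suc y + z))
        arith = solve-∀

      set-dense : s + (u + u) ≤ 6 * count (image reflection set) (s + (u + u))
      set-dense = begin
        -- The prefix has length at most `3u` and the window is at least half full, which gives the
        -- factor 6.
        s + (u + u)                             ≤⟨ +-monoˡ-≤ (u + u) s≤u ⟩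
        u + (u + u)                             ≡⟨ triple u ⟩
        3 * u                                   ≤⟨ *-monoʳ-≤ 3 (fresh-half a u) ⟩
        3 * (2 * count (fresh a u) u)           ≡⟨ *-assoc 3 2 (count (fresh a u) u) ⟨
        6 * count (fresh a u) u                 ≡⟨ cong (6 *_) (sym (count-reverse (fresh a u) u)) ⟩
        6 * count (λ y → fresh a u (u ∸ suc y)) u ≡⟨ cong (6 *_) (count-cong u λ y y<u → sym (inside y y<u)) ⟩
        6 * count (λ y → I (s + u + y)) u       ≤⟨ *-monoʳ-≤ 6 (≤-trans (m≤n+m _ (count I (s + u))) (≤-reflexive (sym (count-+ I (s + u) u)))) ⟩
        6 * count I (s + u + u)                 ≡⟨ cong (λ n → 6 * count I n) (+-assoc s u u) ⟩
        6 * count I (s + (u + u))               ∎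
        where
        open ≤-Reasoning
        I = image reflection set
        triple : ∀ u → u + (u + u) ≡ 3 * u
        triple = solve-∀
        inside : ∀ y → y < u → set (reflect (s + u + y)) ≡ fresh a u (u ∸ suc y)
        inside y y<u = trans (cong set (reflect-window y y<u))
          (set-inside (u ∸ suc y) (∸-monoʳ-< z<s y<u))

-- Geometry of the windows.

module Windows (c q N s : ℕ) (2≤c : 2 ≤ c) (2rᴺ≤s : 2 * (c * suc q) ^ N ≤ s) where
  r : ℕ
  r = c * suc q

  instance
    r-nonZero : NonZero r
    r-nonZero = >-nonZero (≤-trans (<⇒≤ 2≤c) (m≤m*n c (suc q)))

  -- Sizes grow by the factor `r`, and larger windows start further left. The assumption `2rᴺ≤s`
  -- makes all those with index up to `N` fit into the interval.
  u a : ℕ → ℕ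
  u j = s * r ^ j
  a j = next s ∸ (u j + u j)

  s≤u : ∀ j → s ≤ u j
  s≤u j = m≤m*n s (r ^ j) {{m^n≢0 r j}}

  s+2u≤next : ∀ j → j ≤ N → s + (u j + u j) ≤ next s
  s+2u≤next j j≤N = begin
    s + (s * r ^ j + s * r ^ j)   ≡⟨ double s (r ^ j) ⟩
    s + s * (2 * r ^ j)           ≤⟨ +-monoʳ-≤ s (*-monoʳ-≤ s (*-monoʳ-≤ 2 (^-monoʳ-≤ r j≤N))) ⟩
    s + s * (2 * r ^ N)           ≤⟨ +-monoʳ-≤ s (*-monoʳ-≤ s 2rᴺ≤s) ⟩
    s + s * s                     ≤⟨ +-mono-≤ (n≤1+n s) (*-monoʳ-≤ s (n≤1+n s)) ⟩
    next s                        ∎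
    where
    open ≤-Reasoning
    double : ∀ s p → s + (s * p + s * p) ≡ s + s * (2 * p)
    double = solve-∀

  a+2u : ∀ j → j ≤ N → a j + (u j + u j) ≡ next s
  a+2u j j≤N = m∸n+n≡m (≤-trans (m≤n+m _ s) (s+2u≤next j j≤N))

  s≤a : ∀ j → j ≤ N → s ≤ a j
  s≤a j j≤N = m+n≤o⇒m≤o∸n s (s+2u≤next j j≤N)

  a+u≤next : ∀ j → j ≤ N → a j + u j ≤ next s
  a+u≤next j j≤N = ≤-trans (+-monoʳ-≤ (a j) (m≤m+n (u j) (u j))) (≤-reflexive (a+2u j j≤N))

  ratio : ∀ {i j} → i < j → r * u i ≤ u j
  ratio {i} {j} i<j = begin
    r * (s * r ^ i)     ≡⟨ shuffle r s (r ^ i) ⟩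
    s * (r ^ suc i)     ≤⟨ *-monoʳ-≤ s (^-monoʳ-≤ r i<j) ⟩
    s * r ^ j           ∎
    where
    open ≤-Reasoning
    shuffle : ∀ r s p → r * (s * p) ≡ s * (r * p)
    shuffle = solve-∀

  2≤r : 2 ≤ r
  2≤r = ≤-trans 2≤c (m≤m*n c (suc q))

  windows-disjoint : ∀ {i j} → i < j → j ≤ N → a j + u j ≤ a i
  windows-disjoint {i} {j} i<j j≤N = +-cancelʳ-≤ (u j) (a j + u j) (a i) (begin
    a j + u j + u j        ≡⟨ +-assoc (a j) (u j) (u j) ⟩
    a j + (u j + u j)      ≡⟨ a+2u j j≤N ⟩
    next s                 ≡⟨ a+2u i (≤-trans (<⇒≤ i<j) j≤N) ⟨
    a i + (u i + u i)      ≡⟨ cong (a i +_) (cong (u i +_) (sym (+-identityʳ (u i)))) ⟩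
    -- Since `r` is at least 2, window `j` is at least twice as large as window `i`.
    a i + 2 * u i          ≤⟨ +-monoʳ-≤ (a i) (≤-trans (*-monoˡ-≤ (u i) 2≤r) (ratio i<j)) ⟩
    a i + u j              ∎)
    where open ≤-Reasoning

-- Choosing a window harmless for every rule.

module _ (em : ExcludedMiddle 0ℓ) where
  module Choice (B : Set⊆ω) (L : List SkipRule) (q s : ℕ)
    (large : 2 * ((2 * suc (length L)) * suc q) ^ length L ≤ s) where
    N = length L
    open Window em B L q
    open Windows (2 * suc N) q N s (m≤m*n 2 (suc N)) large public

    -- A rule heavy on window `j` samples over `u j / (2(N+1))` of its points, which is at least
    -- `(q+1) * u i` by the choice of `r`, and all of them lie to the left of window `i`.
    heavy⇒spent : ∀ {i j} → i < j → j ≤ N → ∀ F → ¬ Light (a j) (u j) F → Spent (a i) (u i) F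
    heavy⇒spent {i} {j} i<j j≤N F heavy = begin
      q * u i                            ≤⟨ *-cancelˡ-≤ (2 * suc N) scaled ⟩
      count (λ y → Z (a j + y)) (u j)    ≤⟨ m≤n+m _ (count Z (a j)) ⟩
      count Z (a j) + count (λ y → Z (a j + y)) (u j) ≡⟨ count-+ Z (a j) (u j) ⟨
      count Z (a j + u j)                ≤⟨ count-mono-≤ Z (windows-disjoint i<j j≤N) ⟩
      count Z (a i)                      ∎
      where
      open ≤-Reasoning
      Z = Sampled em B F
      scaled : (2 * suc N) * (q * u i) ≤ (2 * suc N) * count (λ y → Z (a j + y)) (u j)
      scaled = begin
        (2 * suc N) * (q * u i)      ≤⟨ *-monoʳ-≤ (2 * suc N) (*-monoˡ-≤ (u i) (n≤1+n q)) ⟩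
        (2 * suc N) * (suc q * u i)  ≡⟨ *-assoc (2 * suc N) (suc q) (u i) ⟨
        r * u i            ≤⟨ ratio i<j ⟩
        u j                ≤⟨ <⇒≤ (≰⇒> heavy) ⟩
        (2 * suc N) * count (λ y → Z (a j + y)) (u j) ∎

    -- The bound `j ≤ N` is part of badness because `all-good-somewhere` compares arbitrary indices,
    -- while windows are known to fit only up to `N`.
    Bad : ℕ → SkipRule → Set
    Bad j F = j ≤ N × ¬ Light (a j) (u j) F × ¬ Spent (a j) (u j) F

    good-window : ∃ λ j → j ≤ N × (∀ {F} → F ∈ L → Light (a j) (u j) F ⊎ Spent (a j) (u j) F)
    good-window
      with j , j≤N , good ← all-good-somewhere L {Bad} (λ j F → em)
        (λ { {x = F} i<j (_ , _ , unspent) (j≤N , heavy , _) → unspent (heavy⇒spent i<j j≤N F heavy) })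
      = j , j≤N , λ {F} F∈ → decide F (All.lookup good F∈) j≤N
      where
      decide : ∀ {j} F → ¬ Bad j F → j ≤ N → Light (a j) (u j) F ⊎ Spent (a j) (u j) F
      decide {j} F ok j≤N with em {Light (a j) (u j) F} | em {Spent (a j) (u j) F}
      ... | yes l | _      = inj₁ l
      ... | no _  | yes sp = inj₂ sp
      ... | no ¬l | no ¬sp = contradiction (j≤N , ¬l , ¬sp) ok

  extend : ∀ B b (L : List SkipRule) q → (∀ x → b ≤ x → B x ≡ false) → Extension B b L q
  extend B b L q B-empty
    -- From time `q + q * b` on, `q * b ≤ t` as `set-sparse` demands; the summand `q` makes the
    -- times unbounded over the stages.
    with S , S-bound ← selected-bounded L B (q + q * b)
    -- The summands of the bound: `q` makes the dense prefix long, `b` puts the interval beyond `B`,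
    -- `S` puts the early selections before it, and the power makes the windows fit.
    with s , big , ss ← large-start (q + b + S + 2 * ((2 * suc (length L)) * suc q) ^ length L)
    = fill (good-window)
    where
    qbS≤s : q + b + S ≤ s
    qbS≤s = m+n≤o⇒m≤o (q + b + S) big
    open Choice B L q s (m+n≤o⇒n≤o (q + b + S) big)
    open Window em B L q
    fill : (∃ λ j → j ≤ N × (∀ {F} → F ∈ L → Light (a j) (u j) F ⊎ Spent (a j) (u j) F)) → Extension B b L q
    fill (j , j≤N , choice) = record
      { set     = set
      ; cutoff  = s
      ; end     = next s
      ; time    = q + q * b
      ; b≤cutoff = b≤s
      ; cutoff<end = s<next s
      ; q≤time  = m≤m+n q (q * b)
      ; agree   = λ x x<s → set-below x (<-≤-trans x<s (s≤a j j≤N))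
      ; empty   = λ x e≤x → set-above x (≤-trans (a+u≤next j j≤N) e≤x)
      ; early   = λ f∈ t t<T → <-≤-trans (S-bound f∈ t t<T) (m+n≤o⇒n≤o (q + b) qbS≤s)
      ; sparse  = λ f∈ t T≤t → set-sparse f∈ t (≤-trans (m≤n+m (q * b) q) T≤t)
      ; dense   = s + (u j + u j) , ≤-trans q≤s (m≤m+n s _) , set-dense
      }
      where
      b≤s : b ≤ s
      b≤s = m+n≤o⇒n≤o q (m+n≤o⇒m≤o (q + b) qbS≤s)
      q≤s : q ≤ s
      q≤s = m+n≤o⇒m≤o q (m+n≤o⇒m≤o (q + b) qbS≤s)
      open Fill s (a j) (u j) b B-empty b≤s (s≤a j j≤N) (s≤u j) ss (a+2u j j≤N) choice

-- From counts to rational densities.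

∣ρₙ-0∣≡ρₙ : ∀ B n → ∣ ρₙ B n -ℚ 0ℚ ∣ ≡ ρₙ B n
∣ρₙ-0∣≡ρₙ B n = trans (cong ∣_∣ (ℚₚ.+-identityʳ (ρₙ B n)))
  (ℚₚ.0≤p⇒∣p∣≡p (ℚₚ.nonNegative⁻¹ (ρₙ B n) {{ℚₚ.normalize-nonNeg (count B (suc n)) (suc n)}}))

toℚᵘ-ρₙ : ∀ B n → toℚᵘ (ρₙ B n) ℚᵘ.≃ ℚᵘ.mkℚᵘ (ℤ.+ count B (suc n)) n
toℚᵘ-ρₙ B n = ℚₚ.toℚᵘ-fromℚᵘ (ℚᵘ.mkℚᵘ (ℤ.+ count B (suc n)) n)

count-small⇒densityZero : ∀ B → (∀ k → ∃ λ N → ∀ n → N ≤ n → k * count B n ≤ n + n) → DensityZero B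
count-small⇒densityZero B small (mkℚ (ℤ.+ zero) d _) (*<* (ℤ.+<+ ()))
count-small⇒densityZero B small (mkℚ ℤ.-[1+ p ] d _) (*<* ())
count-small⇒densityZero B small ε@(mkℚ (ℤ.+ suc p) d _) _
  -- For `ε = (p+1)/(d+1)`, the factor 3 against the 2 in `n + n` makes the inequality strict.
  with N , below ← small (3 * suc d) =
  N , λ n N≤n → subst (_<ℚ ε) (sym (∣ρₙ-0∣≡ρₙ B n)) (ℚₚ.toℚᵘ-cancel-<
    (ℚᵘₚ.<-respˡ-≃ (ℚᵘₚ.≃-sym (toℚᵘ-ρₙ B n)) (ℚᵘ.*<*
      (subst₂ ℤ._<_ (ℤₚ.pos-* (count B (suc n)) (suc d)) (ℤₚ.pos-* (suc p) (suc n))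
        (ℤ.+<+ (bound n (below (suc n) (m≤n⇒m≤1+n N≤n))))))))
  where
  open ≤-Reasoning
  bound : ∀ n → (3 * suc d) * count B (suc n) ≤ suc n + suc n → count B (suc n) * suc d < suc p * suc n
  bound n below = *-cancelˡ-< 3 _ _ (begin-strict
    3 * (count B (suc n) * suc d)      ≡⟨ cong (3 *_) (*-comm (count B (suc n)) (suc d)) ⟩
    3 * (suc d * count B (suc n))      ≡⟨ *-assoc 3 (suc d) (count B (suc n)) ⟨
    (3 * suc d) * count B (suc n)      ≤⟨ below ⟩
    suc n + suc n                      <⟨ +-monoʳ-< (suc n) (m<m+n (suc n) z<s) ⟩
    3 * suc n                          ≤⟨ *-monoʳ-≤ 3 (m≤m+n (suc n) (p * suc n)) ⟩
    3 * (suc p * suc n)                ∎)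

count-large⇒¬densityZero : ∀ B k → (∀ m → ∃ λ n → m ≤ n × n ≤ suc k * count B n) → ¬ DensityZero B
count-large⇒¬densityZero B k large small
  -- The tested `ε` is `1/(k+1)`: a rational stores its denominator minus one.
  with N , below ← small (mkℚ (ℤ.+ 1) k (1-coprimeTo (suc k))) (*<* (ℤ.+<+ z<s))
  with suc n , s≤s N≤n , n≤kc ← large (suc N)
  with ℚᵘ.*<* lt ← ℚᵘₚ.<-respˡ-≃ (toℚᵘ-ρₙ B n)
         (ℚₚ.toℚᵘ-mono-< (subst (_<ℚ mkℚ (ℤ.+ 1) k (1-coprimeTo (suc k))) (∣ρₙ-0∣≡ρₙ B n) (below n N≤n)))
  = <⇒≱ (ℤₚ.drop‿+<+ (subst₂ ℤ._<_ (sym (ℤₚ.pos-* (count B (suc n)) (suc k))) (sym (ℤₚ.pos-* 1 (suc n))) lt))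
        (subst₂ _≤_ (sym (*-identityˡ (suc n))) (*-comm (suc k) (count B (suc n))) n≤kc)

-- The limit of the stages.

module Construction (em : ExcludedMiddle 0ℓ) where
  Realizes : PR 1 → (List (ℕ × Bool) → ℕ) → Set
  Realizes e f = IsSkipRule f × (∀ σ → e [ code σ ∷ [] ]⇓ f σ)

  -- Excluded middle picks some rule computed by `e`; by determinism it agrees pointwise with every
  -- other.
  ruleOf : PR 1 → SkipRule
  ruleOf e with em {∃ (Realizes e)}
  ... | yes (f , rule , _) = f , rule
  ... | no _               = defaultRule

  ruleOf-realizes : ∀ e {f} → Realizes e f → ∀ σ → proj₁ (ruleOf e) σ ≡ f σ
  ruleOf-realizes e {f} (rule , evals) σ with em {∃ (Realizes e)}
  ... | yes (_ , _ , evals′) = ⇓-deterministic (evals′ σ) (evals σ)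
  ... | no ¬p                = contradiction (f , rule , evals) ¬p

  rules : ℕ → List SkipRule
  rules n = map ruleOf (terms n 1)

  rules-complete : ∀ f → ComputableSkipRule f →
    ∃ λ F → (∀ σ → f σ ≡ proj₁ F σ) × ∃ λ n → ∀ d → n ≤ d → F ∈ rules d
  rules-complete f (rule , g , (e , evals) , f≗g) with n , e∈ ← terms-complete e =
    ruleOf e ,
    (λ σ → sym (ruleOf-realizes e (rule , λ σ → subst (e [ code σ ∷ [] ]⇓_) (sym (f≗g σ)) (evals (code σ))) σ)) ,
    n , λ d n≤d → ∈-map⁺ ruleOf (e∈ d n≤d)

  Approximation : Set
  Approximation = Σ Set⊆ω λ B → ∃ λ b → ∀ x → b ≤ x → B x ≡ false

  abstract
    refine : ∀ n ((B , b , _) : Approximation) → Extension B b (rules n) n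
    refine n (B , b , B-empty) = extend em B b (rules n) n B-empty

  approx : ℕ → Approximation
  approx zero    = (λ _ → false) , 0 , λ _ _ → refl
  approx (suc n) = set , end , empty
    where open Extension (refine n (approx n))

  B : ℕ → Set⊆ω
  B n = proj₁ (approx n)

  b : ℕ → ℕ
  b n = proj₁ (proj₂ (approx n))

  module E n = Extension (refine n (approx n))

  b-suc : ∀ n → b n < b (suc n)
  b-suc n = ≤-<-trans (E.b≤cutoff n) (E.cutoff<end n)

  n≤b : ∀ n → n ≤ b n
  n≤b zero    = z≤n
  n≤b (suc n) = ≤-<-trans (n≤b n) (b-suc n)

  b-mono : ∀ {m n} → m ≤ n → b m ≤ b n
  b-mono {m} {n} m≤n with k , refl ← m≤n⇒∃[o]m+o≡n m≤n = go k
    where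
    go : ∀ k → b m ≤ b (m + k)
    go zero    = ≤-reflexive (cong b (sym (+-identityʳ m)))
    go (suc k) = ≤-trans (go k) (≤-trans (<⇒≤ (b-suc (m + k))) (≤-reflexive (cong b (sym (+-suc m k)))))

  B-stable : ∀ {m n} → m ≤ n → ∀ x → x < b m → B n x ≡ B m x
  B-stable {m} {n} m≤n x x<b with k , refl ← m≤n⇒∃[o]m+o≡n m≤n = go k
    where
    go : ∀ k → B (m + k) x ≡ B m x
    go zero    = cong (λ n → B n x) (+-identityʳ m)
    go (suc k) = trans (cong (λ n → B n x) (+-suc m k))
      (trans (E.agree (m + k) x (<-≤-trans x<b (≤-trans (b-mono (m≤m+n m k)) (E.b≤cutoff (m + k))))) (go k))

  -- Stage `suc x` has settled `x`, since `x < b (suc x)`.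
  A : Set⊆ω
  A x = B (suc x) x

  A-stable : ∀ n x → x < b n → A x ≡ B n x
  A-stable n x x<b with ≤-total n (suc x)
  ... | inj₁ n≤ = B-stable n≤ x x<b
  ... | inj₂ ≤n = sym (B-stable ≤n x (n≤b (suc x)))

  A-cutoff : ∀ n x → x < E.cutoff n → A x ≡ B n x
  A-cutoff n x x<s = trans (A-stable (suc n) x (<-trans x<s (E.cutoff<end n))) (E.agree n x x<s)

  -- Until `E.time (suc n)` the run on `B (suc n)` stays below the cutoff of stage `suc n`, where
  -- `A` agrees with `B (suc n)`; so the estimate of stage `n` applies to `A`.
  A-sparse-between : ∀ {F} n → F ∈ rules n → F ∈ rules (suc n) → ∀ t →
    E.time n ≤ t → t ≤ E.time (suc n) → n * count (applySkip (proj₁ F) A) t ≤ t + t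
  A-sparse-between {f , rule} n F∈ F∈′ t lo hi = subst (λ c → n * c ≤ t + t)
    (sym (applySkip-agree f (B (suc n)) A (E.time (suc n))
      (λ t t<T → A-cutoff (suc n) _ (E.early (suc n) F∈′ t t<T)) t hi))
    (E.sparse n F∈ t lo)

  A-sparse : ∀ {F} k → (∀ n → k ≤ n → F ∈ rules n) → ∀ t → E.time k ≤ t →
    k * count (applySkip (proj₁ F) A) t ≤ t + t
  -- The descent starts at stage `k + suc t`, whose time exceeds `t`, and stops at two consecutive
  -- stages whose times enclose `t`.
  A-sparse {F} k F∈ t lo = go (suc t) (≤-trans (m≤n+m (suc t) k) (E.q≤time (k + suc t)))
    where
    go : ∀ i → t < E.time (k + i) → k * count (applySkip (proj₁ F) A) t ≤ t + t
    go zero    hi = contradiction lo (<⇒≱ (subst (λ n → t < E.time n) (+-identityʳ k) hi))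
    go (suc i) hi with <-≤-connex t (E.time (k + i))
    ... | inj₁ hi′ = go i hi′
    ... | inj₂ lo′ = ≤-trans (*-monoˡ-≤ (count (applySkip (proj₁ F) A) t) (m≤m+n k i))
      (A-sparse-between {F} (k + i) (F∈ (k + i) (m≤m+n k i)) (F∈ (suc (k + i)) (≤-trans (m≤m+n k i) (n≤1+n _))) t lo′
        (subst (λ n → t ≤ E.time n) (+-suc k i) (<⇒≤ hi)))

  A-weaklyStochastic : ZeroWeaklyStochastic A
  A-weaklyStochastic f comp-f with F@(g , _) , f≗g , n , F∈ ← rules-complete f comp-f =
    -- In `n + k`, `n` ensures that the rule is already listed and `k` that the stage bound is
    -- strong enough.
    count-small⇒densityZero (applySkip f A) λ k → E.time (n + k) , λ t T≤t → begin
      k * count (applySkip f A) t         ≡⟨ cong (k *_) (count-cong t λ x _ → cong A (same x)) ⟩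
      k * count (applySkip g A) t         ≤⟨ *-monoˡ-≤ (count (applySkip g A) t) (m≤n+m k n) ⟩
      (n + k) * count (applySkip g A) t   ≤⟨ A-sparse {F} (n + k) (λ d p → F∈ d (m+n≤o⇒m≤o n p)) t T≤t ⟩
      t + t                               ∎
    where
    open ≤-Reasoning
    same : ∀ x → selected f A x ≡ selected g A x
    same x = trans (cong f (history-ext f≗g A x)) (f≗g (history g A x))

  A-not-intrinsicallySmall : ¬ IntrinsicallySmall A
  A-not-intrinsicallySmall small = count-large⇒¬densityZero (image reflection A) 5 large
    (small reflection (reflectᵖ , reflectᵖ-⇓))
    where
    -- No stage removes an element, so the dense prefix found at each stage stays dense for `A`.
    B⊆A : ∀ n x → B n x ≡ true → A x ≡ true
    B⊆A n x Bx with <-≤-connex x (b n)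
    ... | inj₁ x<b = trans (A-stable n x x<b) Bx
    ... | inj₂ b≤x = contradiction (trans (sym Bx) (proj₂ (proj₂ (approx n)) x b≤x)) λ ()
    large : ∀ m → ∃ λ n → m ≤ n × n ≤ 6 * count (image reflection A) n
    large m with n , m≤n , dense ← E.dense m =
      n , m≤n , ≤-trans dense (*-monoʳ-≤ 6 (count-mono n λ x _ → B⊆A (suc m) (reflect x)))

theorem4 : ExcludedMiddle 0ℓ →
    Σ Set⊆ω λ A → ZeroWeaklyStochastic A × ¬ IntrinsicallySmall A
theorem4 em = A , A-weaklyStochastic , A-not-intrinsicallySmall
  where open Construction em
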